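{- Let $G$ be a matroid on $[n]$ with no loops and no multiple points, let $\mathbb{K}$ be a field or commutative ring, and fix a linear order on $[n]$. Then the set $\{\bar{a}_S : S\text{ an nbb set of }G\}$ is linearly independent in the quadratic closure $\bar{A}(G)$.
   Context: $\mathcal{E}$ is the exterior algebra over $\mathbb{K}$ on $e_1,\dots,e_n$; for $S=\{i_1<\dots<i_p\}$, $e_S=e_{i_1}\cdots e_{i_p}$. $\partial(e_{i_1}\cdots e_{i_p})=\sum_{k}(-1)^{k-1}e_{i_1}\cdots\widehat{e_{i_k}}\cdots e_{i_p}$. $\mathcal{I}$ is the ideal generated by $\partial e_S$ for $S$ dependent in $G$; $\mathcal{J}$ is the ideal generated by the degree-two component of $\mathcal{I}$; $\bar{A}(G)=\mathcal{E}/\mathcal{J}$ and $\bar{a}_S$ is the image of $e_S$. A subset $S$ is line-closed if $\operatorname{cl}(\{i,j\})\subseteq S$ for all $i,j\in S$ ($\operatorname{cl}$ = matroid closure); $\operatorname{lc}(S)$ is the intersection of the line-closed sets containing $S$. An increasing subset $S=\{i_1<\dots<i_p\}$ is nbb if $i_k=\min\operatorname{lc}(\{i_k,\dots,i_p\})$ for each $k$. -}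

module Defs where

open import Level using (Level; _⊔_)
open import Data.Nat as ℕ using (ℕ; zero; suc)
open import Data.Bool using (Bool; true; false; if_then_else_; _∧_; _∨_; not)
open import Data.Fin as Fin using (Fin; zero; suc; toℕ)
open import Data.Fin.Subset using (Subset; _∈_; _∉_; _⊆_; _∪_; ⁅_⁆; ∣_∣; ⊥) renaming (_-_ to _∖ₑ_)
open import Data.Vec using (Vec; []; _∷_; lookup; tabulate; toList)
open import Data.List using (List; []; _∷_; map; foldr; _++_)
open import Data.Product using (Σ; ∃; _×_; _,_)
open import Data.Sum using (_⊎_)
open import Relation.Nullary using (¬_)
open import Relation.Binary.PropositionalEquality using (_≡_; _≢_)
open import Algebra.Bundles using (CommutativeRing)

record Matroid (n : ℕ) : Set₁ where
  field
    Indep   : Subset n → Set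
    indep-∅ : Indep ⊥
    indep-⊆ : ∀ {X Y} → X ⊆ Y → Indep Y → Indep X
    augment : ∀ {X Y} → Indep X → Indep Y → ∣ X ∣ ℕ.< ∣ Y ∣ →
              ∃ λ y → y ∈ Y × y ∉ X × Indep (X ∪ ⁅ y ⁆)

module _ {n : ℕ} (G : Matroid n) where
  open Matroid G

  Dependent : Subset n → Set
  Dependent S = ¬ Indep S

  Loopless : Set
  Loopless = ∀ i → Indep ⁅ i ⁆

  NoMultiplePoints : Set
  NoMultiplePoints = ∀ i j → i ≢ j → Indep (⁅ i ⁆ ∪ ⁅ j ⁆)

  -- matroid closure: k ∈ cl X  iff  k ∈ X or some independent I ⊆ X
  -- becomes dependent when k is added (equivalently r(X ∪ k) = r(X))
  InCl : Subset n → Fin n → Set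
  InCl X k = k ∈ X ⊎ (∃ λ I → I ⊆ X × Indep I × ¬ Indep (I ∪ ⁅ k ⁆))

  LineClosed : Subset n → Set
  LineClosed S = ∀ i j k → i ∈ S → j ∈ S → InCl (⁅ i ⁆ ∪ ⁅ j ⁆) k → k ∈ S

  InLc : Subset n → Fin n → Set
  InLc S k = ∀ T → LineClosed T → S ⊆ T → k ∈ T

  tailFrom : Subset n → Fin n → Subset n
  tailFrom S i = tabulate λ j → lookup S j ∧ (toℕ i ℕ.≤ᵇ toℕ j)

  -- S is nbb (w.r.t. the natural order of Fin n): every i ∈ S is the
  -- minimum of lc({j ∈ S : i ≤ j})  (i belongs to that set, so this says
  -- that every element of it is ≥ i)
  NBB : Subset n → Set
  NBB S = ∀ i → i ∈ S → ∀ j → InLc (tailFrom S i) j → i Fin.≤ j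

allSubsets : (n : ℕ) → List (Subset n)
allSubsets zero    = [] ∷ []
allSubsets (suc n) = map (true ∷_) (allSubsets n) ++ map (false ∷_) (allSubsets n)

eqSub : ∀ {n} → Subset n → Subset n → Bool
eqSub []       []       = true
eqSub (a ∷ S) (b ∷ T) = (if a then b else not b) ∧ eqSub S T

disjointB : ∀ {n} → Subset n → Subset n → Bool
disjointB []       []       = true
disjointB (a ∷ S) (b ∷ T) = not (a ∧ b) ∧ disjointB S T

inversions : ∀ {n} → Subset n → Subset n → ℕ
inversions []       []       = 0
inversions (a ∷ S) (b ∷ T) = (if b then ∣ S ∣ else 0) ℕ.+ inversions S T

below : ∀ {n} → Subset n → Fin n → ℕ
below (a ∷ S) zero    = 0
below (a ∷ S) (suc i) = (if a then 1 else 0) ℕ.+ below S i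

-- The exterior algebra E over a commutative ring R on e_1,…,e_n.
-- An element is its coefficient function on the basis {e_S : S ⊆ [n]}.

module Exterior {c ℓ} (R : CommutativeRing c ℓ) (n : ℕ) where
  open CommutativeRing R

  Elem : Set c
  Elem = Subset n → Carrier

  _≋_ : Elem → Elem → Set ℓ
  x ≋ y = ∀ U → x U ≈ y U

  sign : ℕ → Carrier
  sign zero    = 1#
  sign (suc k) = - sign k

  sumL : {A : Set} → List A → (A → Carrier) → Carrier
  sumL xs f = foldr (λ a r → f a + r) 0# xs

  δ : Bool → Carrier → Carrier
  δ b r = if b then r else 0#

  0E : Elem
  0E U = 0#

  _+E_ : Elem → Elem → Elem
  (x +E y) U = x U + y U

  -- e_S ∧ e_T = (-1)^{inv(S,T)} e_{S ∪ T} if S ∩ T = ∅, and 0 otherwise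
  _*E_ : Elem → Elem → Elem
  (x *E y) U = sumL (allSubsets n) λ S → sumL (allSubsets n) λ T →
    δ (disjointB S T ∧ eqSub (S ∪ T) U) (sign (inversions S T) * (x S * y T))

  -- ∂ e_S = Σ_k (-1)^{k-1} e_{S ∖ i_k}
  ∂e : Subset n → Elem
  ∂e S U = sumL (toList (tabulate {n = n} (λ i → i))) λ i →
    δ (lookup S i ∧ eqSub (S ∖ₑ i) U) (sign (below S i))

  data InIdeal {p} (P : Elem → Set p) : Elem → Set (c ⊔ ℓ ⊔ p) where
    gen  : ∀ a q b → P q → InIdeal P ((a *E q) *E b)
    zro  : InIdeal P 0E
    add  : ∀ {x y} → InIdeal P x → InIdeal P y → InIdeal P (x +E y)
    resp : ∀ {x y} → x ≋ y → InIdeal P x → InIdeal P y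

  HomogDeg2 : Elem → Set ℓ
  HomogDeg2 x = ∀ U → ∣ U ∣ ≢ 2 → x U ≈ 0#

  module _ (G : Matroid n) where
    GenI : Elem → Set ℓ
    GenI q = Σ (Subset n) λ S → Dependent G S × (q ≋ ∂e S)

    InI : Elem → Set (c ⊔ ℓ)
    InI = InIdeal GenI

    InI₂ : Elem → Set (c ⊔ ℓ)
    InI₂ x = InI x × HomogDeg2 x

    -- J = ideal generated by the degree-two component of I;
    -- Ā(G) = E / J, so x maps to 0 in Ā(G) iff InJ x
    InJ : Elem → Set (c ⊔ ℓ)
    InJ = InIdeal InI₂

module Submission where

-- The span in the sense of lc is needed only relative to a finite list D of
-- collinear triples, namely those that occur in a given derivation of x ∈ 𝓙;
-- unlike lc itself this span is decidable, it is contained in lc, and the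
-- generators of degree two that matter are the ∂e_{abc} with (a,b,c) in D.
--
-- For S = {i_1 < … < i_p} let X_k be the span of {i_k, …, i_p}.  Substituting
-- e_{i_k} for e_j when k is the largest index with j ∈ X_k, and 0 for e_j when
-- j ∉ X_1, is an algebra map.  Of three points in a triple at least two are
-- identified, since every X_k that contains two of them contains the third; so
-- the map kills ∂e_{abc} and hence 𝓙.  Its e_S-coefficient is therefore a
-- functional vanishing at x.  If S is nbb then i_k = min X_k, so the map never
-- increases an index: the functional is 1 at e_S and is 0 at every e_T, T ≠ S,
-- whose sum of indices is not larger than that of S.  This triangularity gives
-- x_S = 0 by induction.

open import Defs
open import Algebra.Bundles using (CommutativeRing)
open import Data.Bool using (true; false; _∧_)
open import Data.Bool.Properties using (∧-zeroʳ; T-≡; T-∧)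
open import Data.Fin as Fin using (Fin; zero; suc; toℕ)
import Data.Fin.Properties as Finₚ
open import Data.Fin.Subset using (Subset; _∈_; _⊆_; _∪_; ⁅_⁆; ⊥; ∣_∣; _-_)
open import Data.Fin.Subset.Properties using
  (p─⊥≡p; ∪-idem; x∈⁅x⁆; x∈p∪q⁺; _∈?_; _⊆?_; anySubset?)
open import Data.List as List using (List; []; _∷_; _++_; length)
open import Data.List.Membership.Propositional using () renaming (_∈_ to _∈ₗ_)
open import Data.List.Properties using (++-assoc; map-++; length-++; map-∘; map-cong-local)
open import Data.List.Relation.Unary.All as All using (All; []; _∷_)
import Data.List.Relation.Unary.All.Properties as Allₚ
open import Data.List.Relation.Unary.Any using (here; there)
open import Data.Nat as ℕ using (ℕ; zero; suc; z≤n; s≤s)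
open import Data.Nat.Induction using (<-wellFounded)
open import Data.Nat.ListAction using (sum)
import Data.Nat.Properties as ℕₚ
open import Algebra.Properties.CommutativeSemigroup ℕₚ.+-commutativeSemigroup using (x∙yz≈y∙xz)
open import Data.Product using (_×_; _,_; proj₁; proj₂; ∃)
open import Data.Sum using (_⊎_; inj₁; inj₂)
open import Data.Unit using (⊤)
open import Data.Vec using ([]; _∷_; lookup; tabulate; toList; _[_]≔_; here; there)
open import Data.Vec.Properties using
  ([]≔-commutes; lookup∘update; lookup∘update′; lookup∘tabulate; []=⇒lookup; lookup⇒[]=)
open import Function using (_∘_; Equivalence)
import Induction.WellFounded as WF
import Relation.Binary.Construct.On as On
open import Relation.Binary.PropositionalEquality as ≡ using (_≡_; _≢_)
open import Relation.Nullary using (¬_; yes; no; does; contradiction)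
open import Relation.Nullary.Decidable using
  (dec-true; dec-false; decidable-stable; _×-dec_; _→-dec_; ¬?)
open import Relation.Unary using (Decidable)

-- Subsets as increasing words

-- The labelling `g` absorbs the shift by `suc` in a recursion on the subset; `letters` is the
-- instance at the identity.
word : ∀ {X : Set} {m} → (Fin m → X) → Subset m → List X
word g []          = []
word g (true ∷ S)  = g zero ∷ word (g ∘ suc) S
word g (false ∷ S) = word (g ∘ suc) S

letters : ∀ {m} → Subset m → List (Fin m)
letters = word (λ i → i)

indices : ∀ m → List (Fin m)
indices m = toList (tabulate (λ i → i))

length-word : ∀ {X : Set} {m} (g : Fin m → X) S → length (word g S) ≡ ∣ S ∣
length-word g []          = ≡.refl
length-word g (true ∷ S)  = ≡.cong suc (length-word (g ∘ suc) S)
length-word g (false ∷ S) = length-word (g ∘ suc) S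

word-⊥ : ∀ {X : Set} {m} (g : Fin m → X) → word g ⊥ ≡ []
word-⊥ {m = zero}  g = ≡.refl
word-⊥ {m = suc m} g = word-⊥ (g ∘ suc)

map-word : ∀ {X Y : Set} {m} (f : X → Y) (g : Fin m → X) S →
           List.map f (word g S) ≡ word (f ∘ g) S
map-word f g []          = ≡.refl
map-word f g (true ∷ S)  = ≡.cong (f (g zero) ∷_) (map-word f (g ∘ suc) S)
map-word f g (false ∷ S) = map-word f (g ∘ suc) S

word-suc : ∀ {m} (S : Subset m) → word Fin.suc S ≡ List.map Fin.suc (letters S)
word-suc S = ≡.sym (map-word Fin.suc (λ i → i) S)

eqSub-refl : ∀ {m} (S : Subset m) → eqSub S S ≡ true
eqSub-refl []          = ≡.refl
eqSub-refl (true ∷ S)  = eqSub-refl S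
eqSub-refl (false ∷ S) = eqSub-refl S

eqSub⇒≡ : ∀ {m} (S T : Subset m) → eqSub S T ≡ true → S ≡ T
eqSub⇒≡ []          []          _ = ≡.refl
eqSub⇒≡ (true ∷ S)  (true ∷ T)  p = ≡.cong (true ∷_) (eqSub⇒≡ S T p)
eqSub⇒≡ (false ∷ S) (false ∷ T) p = ≡.cong (false ∷_) (eqSub⇒≡ S T p)

≢⇒eqSub : ∀ {m} (S T : Subset m) → S ≢ T → eqSub S T ≡ false
≢⇒eqSub S T S≢T with eqSub S T in eq
... | true  = contradiction (eqSub⇒≡ S T eq) S≢T
... | false = ≡.refl

p-x≡p[x]≔false : ∀ {m} (S : Subset m) i → S - i ≡ S [ i ]≔ false
p-x≡p[x]≔false (true ∷ S)  zero    = ≡.cong (false ∷_) (p─⊥≡p S)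
p-x≡p[x]≔false (false ∷ S) zero    = ≡.cong (false ∷_) (p─⊥≡p S)
p-x≡p[x]≔false (true ∷ S)  (suc i) = ≡.cong (true ∷_) (p-x≡p[x]≔false S i)
p-x≡p[x]≔false (false ∷ S) (suc i) = ≡.cong (false ∷_) (p-x≡p[x]≔false S i)

sum-remove : ∀ {m} (f : Fin m → ℕ) S i → lookup S i ≡ true →
             sum (word f S) ≡ f i ℕ.+ sum (word f (S [ i ]≔ false))
sum-remove f (true ∷ S)  zero    _  = ≡.refl
sum-remove f (false ∷ S) (suc i) Si = sum-remove (f ∘ suc) S i Si
sum-remove f (true ∷ S)  (suc i) Si =
  ≡.trans (≡.cong (f zero ℕ.+_) (sum-remove (f ∘ suc) S i Si))
          (x∙yz≈y∙xz (f zero) (f (suc i)) _)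

∈-word : ∀ {X : Set} {m} (g : Fin m → X) {S i} → i ∈ S → g i ∈ₗ word g S
∈-word g {true ∷ S}  here        = here ≡.refl
∈-word g {true ∷ S}  (there i∈S) = there (∈-word (g ∘ suc) i∈S)
∈-word g {false ∷ S} (there i∈S) = ∈-word (g ∘ suc) i∈S

∈-letters : ∀ {m} {S : Subset m} {i} → i ∈ S → i ∈ₗ letters S
∈-letters = ∈-word (λ i → i)

all-word : ∀ {X : Set} {m} {P : X → Set} (g : Fin m → X) S →
           (∀ {i} → i ∈ S → P (g i)) → All P (word g S)
all-word g []          p = []
all-word g (true ∷ S)  p = p here ∷ all-word (g ∘ suc) S (p ∘ there)
all-word g (false ∷ S) p = all-word (g ∘ suc) S (p ∘ there)

long-sandwich : ∀ {X : Set} (u t v : List X) →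
  3 ℕ.≤ (length u ℕ.+ length t) ℕ.+ length v → length ((u ++ t) ++ v) ≢ 2
long-sandwich u t v 3≤ eq = ℕₚ.<⇒≢ 3≤ (≡.sym (≡.trans (≡.sym
  (≡.trans (length-++ (u ++ t)) (≡.cong (ℕ._+ length v) (length-++ u)))) eq))

-- Line-closedness tested on one triple only. It makes no reference to `Indep`, which need not be
-- decidable, and is therefore decidable itself.
ClosedUnder : ∀ {n} → Subset n → Fin n × Fin n × Fin n → Set
ClosedUnder T (a , b , c) =
  (a ∈ T → b ∈ T → c ∈ T) × (a ∈ T → c ∈ T → b ∈ T) × (b ∈ T → c ∈ T → a ∈ T)

module Functionals {c ℓ} (R : CommutativeRing c ℓ) (n : ℕ) where
  open CommutativeRing R hiding (zero; _-_)
  open Exterior R n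
  open import Algebra.Properties.Ring ring
  open import Algebra.Properties.CommutativeSemigroup +-commutativeSemigroup
    using (interchange)
  open import Relation.Binary.Reasoning.Setoid setoid

  -- Finite sums over a commutative ring

  δ-cong : ∀ b {r s} → r ≈ s → δ b r ≈ δ b s
  δ-cong true  p = p
  δ-cong false _ = refl

  δ-zero : ∀ b {r} → r ≈ 0# → δ b r ≈ 0#
  δ-zero true  p = p
  δ-zero false _ = refl

  δ-neg : ∀ b r → δ b (- r) ≈ - δ b r
  δ-neg true  r = refl
  δ-neg false r = sym -0#≈0#

  δ-*ˡ : ∀ b r s → r * δ b s ≈ δ b (r * s)
  δ-*ˡ true  r s = refl
  δ-*ˡ false r s = zeroʳ r

  sum-cong : ∀ {A : Set} (xs : List A) {f g} → (∀ a → f a ≈ g a) → sumL xs f ≈ sumL xs g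
  sum-cong []       p = refl
  sum-cong (x ∷ xs) p = +-cong (p x) (sum-cong xs p)

  sum-zero : ∀ {A : Set} (xs : List A) {f} → (∀ a → f a ≈ 0#) → sumL xs f ≈ 0#
  sum-zero []       p = refl
  sum-zero (x ∷ xs) p = trans (+-cong (p x) (sum-zero xs p)) (+-identityˡ 0#)

  sum-+ : ∀ {A : Set} (xs : List A) f g →
          sumL xs (λ a → f a + g a) ≈ sumL xs f + sumL xs g
  sum-+ []       f g = sym (+-identityˡ 0#)
  sum-+ (x ∷ xs) f g = trans (+-congˡ (sum-+ xs f g)) (interchange _ _ _ _)

  sum-*ˡ : ∀ {A : Set} (xs : List A) r f → r * sumL xs f ≈ sumL xs (λ a → r * f a)
  sum-*ˡ []       r f = zeroʳ r
  sum-*ˡ (x ∷ xs) r f = trans (distribˡ r _ _) (+-congˡ (sum-*ˡ xs r f))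

  sum-*ʳ : ∀ {A : Set} (xs : List A) r f → sumL xs f * r ≈ sumL xs (λ a → f a * r)
  sum-*ʳ []       r f = zeroˡ r
  sum-*ʳ (x ∷ xs) r f = trans (distribʳ r _ _) (+-congˡ (sum-*ʳ xs r f))

  sum-neg : ∀ {A : Set} (xs : List A) f → sumL xs (λ a → - f a) ≈ - sumL xs f
  sum-neg []       f = sym -0#≈0#
  sum-neg (x ∷ xs) f = trans (+-congˡ (sum-neg xs f)) (-‿+-comm _ _)

  sum-swap : ∀ {A B : Set} (xs : List A) (ys : List B) (f : A → B → Carrier) →
             sumL xs (λ a → sumL ys (f a)) ≈ sumL ys (λ b → sumL xs (λ a → f a b))
  sum-swap []       ys f = sym (sum-zero ys (λ _ → refl))
  sum-swap (x ∷ xs) ys f =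
    trans (+-congˡ (sum-swap xs ys f)) (sym (sum-+ ys (f x) _))

  sum-++ : ∀ {A : Set} (xs ys : List A) f → sumL (xs ++ ys) f ≈ sumL xs f + sumL ys f
  sum-++ []       ys f = sym (+-identityˡ _)
  sum-++ (x ∷ xs) ys f = trans (+-congˡ (sum-++ xs ys f)) (sym (+-assoc _ _ _))

  sum-map : ∀ {A B : Set} (h : A → B) xs f → sumL (List.map h xs) f ≈ sumL xs (f ∘ h)
  sum-map h []       f = refl
  sum-map h (x ∷ xs) f = +-congˡ (sum-map h xs f)

  sum-tabulate : ∀ {A B : Set} {m} (h : A → B) (t : Fin m → A) f →
    sumL (toList (tabulate (h ∘ t))) f ≈ sumL (toList (tabulate t)) (f ∘ h)
  sum-tabulate {m = zero}  h t f = refl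
  sum-tabulate {m = suc m} h t f = +-congˡ (sum-tabulate h (t ∘ suc) f)

  sum-indices-suc : ∀ {m} (f : Fin (suc m) → Carrier) →
    sumL (toList (tabulate {n = m} Fin.suc)) f ≈ sumL (indices m) (f ∘ Fin.suc)
  sum-indices-suc = sum-tabulate Fin.suc (λ i → i)

  sum-single : ∀ {m} (S : Subset m) f → (∀ T → T ≢ S → f T ≈ 0#) →
               sumL (allSubsets m) f ≈ f S
  sum-single {zero}  []      f z = +-identityʳ _
  sum-single {suc m} (b ∷ S) f z = begin
    sumL (allSubsets (suc m)) f
      ≈⟨ sum-++ (List.map (true ∷_) (allSubsets m)) _ f ⟩
    sumL (List.map (true ∷_) (allSubsets m)) f + sumL (List.map (false ∷_) (allSubsets m)) f
      ≈⟨ +-cong (sum-map (true ∷_) (allSubsets m) f) (sum-map (false ∷_) (allSubsets m) f) ⟩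
    sumL (allSubsets m) (f ∘ (true ∷_)) + sumL (allSubsets m) (f ∘ (false ∷_))
      ≈⟨ pick b z ⟩
    f (b ∷ S) ∎
    where
    other : ∀ b → (∀ T → T ≢ b ∷ S → f T ≈ 0#) →
            sumL (allSubsets m) (f ∘ (b ∷_)) ≈ f (b ∷ S)
    other b z = sum-single S (f ∘ (b ∷_)) (λ T T≢S → z _ (λ { ≡.refl → T≢S ≡.refl }))
    pick : ∀ b → (∀ T → T ≢ b ∷ S → f T ≈ 0#) →
           sumL (allSubsets m) (f ∘ (true ∷_)) + sumL (allSubsets m) (f ∘ (false ∷_)) ≈ f (b ∷ S)
    pick true  z = trans (+-cong (other true z) (sum-zero (allSubsets m) (λ T → z _ (λ ()))))
                         (+-identityʳ _)
    pick false z = trans (+-cong (sum-zero (allSubsets m) (λ T → z _ (λ ()))) (other false z))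
                         (+-identityˡ _)

  -- Alternating functionals on words

  Functional : Set → Set c
  Functional X = List X → Carrier

  -- These are the functionals on the tensor algebra that factor through the exterior algebra.
  -- `repeat` is a separate field because `swap` gives only that twice the value is zero.
  record Alternating {X : Set} (w : Functional X) : Set ℓ where
    field
      swap   : ∀ u i j v → w (u ++ i ∷ j ∷ v) ≈ - w (u ++ j ∷ i ∷ v)
      repeat : ∀ u i v → w (u ++ i ∷ i ∷ v) ≈ 0#

  open Alternating

  prefix : ∀ {X} {w : Functional X} u → Alternating w → Alternating (λ t → w (u ++ t))
  prefix {w = w} u alt .swap u′ i j v
    rewrite ≡.sym (++-assoc u u′ (i ∷ j ∷ v)) | ≡.sym (++-assoc u u′ (j ∷ i ∷ v)) =
    swap alt (u ++ u′) i j v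
  prefix {w = w} u alt .repeat u′ i v
    rewrite ≡.sym (++-assoc u u′ (i ∷ i ∷ v)) = repeat alt (u ++ u′) i v

  suffix : ∀ {X} {w : Functional X} v → Alternating w → Alternating (λ t → w (t ++ v))
  suffix v alt .swap u i j v′
    rewrite ++-assoc u (i ∷ j ∷ v′) v | ++-assoc u (j ∷ i ∷ v′) v =
    swap alt u i j (v′ ++ v)
  suffix v alt .repeat u i v′
    rewrite ++-assoc u (i ∷ i ∷ v′) v = repeat alt u i (v′ ++ v)

  sandwich : ∀ {X} → List X → List X → Functional X → Functional X
  sandwich u v w t = w ((u ++ t) ++ v)

  sandwich-alternating : ∀ {X} {w : Functional X} u v →
                         Alternating w → Alternating (sandwich u v w)
  sandwich-alternating u v alt = prefix u (suffix v alt)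

  pullback-alternating : ∀ {X Y} (ρ : X → Y) {w : Functional Y} →
                         Alternating w → Alternating (w ∘ List.map ρ)
  pullback-alternating ρ alt .swap u i j v
    rewrite map-++ ρ u (i ∷ j ∷ v) | map-++ ρ u (j ∷ i ∷ v) = swap alt (List.map ρ u) _ _ _
  pullback-alternating ρ alt .repeat u i v
    rewrite map-++ ρ u (i ∷ i ∷ v) = repeat alt (List.map ρ u) _ _

  -- One transposition, hence one sign, for each letter of `u` that `x` passes.
  move-front : ∀ {X} {w : Functional X} → Alternating w → ∀ u x v →
               w (u ++ x ∷ v) ≈ sign (length u) * w (x ∷ u ++ v)
  move-front alt []      x v = sym (*-identityˡ _)
  move-front {w = w} alt (y ∷ u) x v = begin
    w (y ∷ u ++ x ∷ v)                       ≈⟨ move-front (prefix (y ∷ []) alt) u x v ⟩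
    sign (length u) * w (y ∷ x ∷ u ++ v)     ≈⟨ *-congˡ (swap alt [] y x _) ⟩
    sign (length u) * - w (x ∷ y ∷ u ++ v)   ≈⟨ -‿distribʳ-* _ _ ⟨
    - (sign (length u) * w (x ∷ y ∷ u ++ v)) ≈⟨ -‿distribˡ-* _ _ ⟩
    - sign (length u) * w (x ∷ y ∷ u ++ v)   ∎

  repeat-apart : ∀ {X} {w : Functional X} → Alternating w → ∀ x u v →
                 w (x ∷ u ++ x ∷ v) ≈ 0#
  repeat-apart {w = w} alt x u v = begin
    w (x ∷ u ++ x ∷ v)                   ≈⟨ move-front (prefix (x ∷ []) alt) u x v ⟩
    sign (length u) * w (x ∷ x ∷ u ++ v) ≈⟨ *-congˡ (repeat alt [] x _) ⟩
    sign (length u) * 0#                 ≈⟨ zeroʳ _ ⟩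
    0#                                   ∎

  sign-+ : ∀ i j → sign (i ℕ.+ j) ≈ sign i * sign j
  sign-+ zero    j = sym (*-identityˡ _)
  sign-+ (suc i) j = trans (-‿cong (sign-+ i j)) (-‿distribˡ-* _ _)

  -- Sorting the concatenation moves each letter of `T` to the left past the larger letters of `S`,
  -- and `inversions S T` counts these passages; a common element gives a repeated letter.
  merge : ∀ {X m} {w : Functional X} → Alternating w → (g : Fin m → X) (S T : Subset m) →
          w (word g S ++ word g T) ≈
          δ (disjointB S T) (sign (inversions S T) * w (word g (S ∪ T)))
  merge alt g []          []          = sym (*-identityˡ _)
  merge alt g (true ∷ S)  (true ∷ T)  = repeat-apart alt _ _ _
  merge alt g (true ∷ S)  (false ∷ T) = merge (prefix (g zero ∷ []) alt) (g ∘ suc) S T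
  merge alt g (false ∷ S) (false ∷ T) = merge alt (g ∘ suc) S T
  merge {w = w} alt g (false ∷ S) (true ∷ T) = begin
    w (word g′ S ++ g zero ∷ word g′ T)
      ≈⟨ move-front alt (word g′ S) (g zero) (word g′ T) ⟩
    sign (length (word g′ S)) * w (g zero ∷ word g′ S ++ word g′ T)
      ≈⟨ *-cong (reflexive (≡.cong sign (length-word g′ S)))
                (merge (prefix (g zero ∷ []) alt) g′ S T) ⟩
    sign ∣ S ∣ * δ (disjointB S T) (sign (inversions S T) * W)
      ≈⟨ δ-*ˡ (disjointB S T) _ _ ⟩
    δ (disjointB S T) (sign ∣ S ∣ * (sign (inversions S T) * W))
      ≈⟨ δ-cong (disjointB S T) (trans (sym (*-assoc _ _ _)) (*-congʳ (sym (sign-+ ∣ S ∣ _)))) ⟩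
    δ (disjointB S T) (sign (∣ S ∣ ℕ.+ inversions S T) * W) ∎
    where
    g′ = g ∘ suc
    W  = w (g zero ∷ word g′ (S ∪ T))

  -- Pairing the exterior algebra with functionals

  ⟨_,_⟩ : Elem → Functional (Fin n) → Carrier
  ⟨ x , w ⟩ = sumL (allSubsets n) λ U → x U * w (letters U)

  pair-resp : ∀ w {x y} → x ≋ y → ⟨ x , w ⟩ ≈ ⟨ y , w ⟩
  pair-resp w x≋y = sum-cong (allSubsets n) (λ U → *-congʳ (x≋y U))

  pair-0 : ∀ w → ⟨ 0E , w ⟩ ≈ 0#
  pair-0 w = sum-zero (allSubsets n) (λ U → zeroˡ _)

  pair-+ : ∀ x y w → ⟨ x +E y , w ⟩ ≈ ⟨ x , w ⟩ + ⟨ y , w ⟩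
  pair-+ x y w =
    trans (sum-cong (allSubsets n) (λ U → distribʳ _ _ _)) (sum-+ (allSubsets n) _ _)

  sum₂ : (Subset n → Subset n → Carrier) → Carrier
  sum₂ f = sumL (allSubsets n) λ S → sumL (allSubsets n) λ T → f S T

  sum₂-cong : ∀ {f g} → (∀ S T → f S T ≈ g S T) → sum₂ f ≈ sum₂ g
  sum₂-cong p = sum-cong (allSubsets n) (λ S → sum-cong (allSubsets n) (p S))

  -- By `merge`, the structure constants of `_*E_` are the factors that sorting a concatenated word
  -- costs an alternating functional. Products thus become concatenations.
  pair-* : ∀ {w} → Alternating w → ∀ x y →
           ⟨ x *E y , w ⟩ ≈ sum₂ λ S T → (x S * y T) * w (letters S ++ letters T)
  pair-* {w} alt x y = begin
    sumL all (λ U → sum₂ (λ S T → term S T U) * w (letters U))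
      ≈⟨ sum-cong all (λ U → trans (sum-*ʳ all _ _)
                                   (sum-cong all (λ S → sum-*ʳ all _ _))) ⟩
    sumL all (λ U → sum₂ (λ S T → term S T U * w (letters U)))
      ≈⟨ sum-swap all all _ ⟩
    sumL all (λ S → sumL all (λ U → sumL all (λ T → term S T U * w (letters U))))
      ≈⟨ sum-cong all (λ S → sum-swap all all _) ⟩
    sum₂ (λ S T → sumL all (λ U → term S T U * w (letters U)))
      ≈⟨ sum₂-cong (λ S T → trans (sum-single (S ∪ T) _ (off S T)) (on S T)) ⟩
    sum₂ (λ S T → (x S * y T) * w (letters S ++ letters T)) ∎
    where
    all = allSubsets n
    term : Subset n → Subset n → Subset n → Carrier
    term S T U = δ (disjointB S T ∧ eqSub (S ∪ T) U) (sign (inversions S T) * (x S * y T))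
    off : ∀ S T U → U ≢ S ∪ T → term S T U * w (letters U) ≈ 0#
    off S T U U≢ rewrite ≢⇒eqSub (S ∪ T) U (U≢ ∘ ≡.sym) | ∧-zeroʳ (disjointB S T) = zeroˡ _
    rearrange : ∀ d s r v → δ (d ∧ true) (s * r) * v ≈ r * δ d (s * v)
    rearrange false s r v = trans (zeroˡ _) (sym (zeroʳ _))
    rearrange true  s r v = trans (*-congʳ (*-comm s r)) (*-assoc r s v)
    on : ∀ S T → term S T (S ∪ T) * w (letters (S ∪ T)) ≈
                 (x S * y T) * w (letters S ++ letters T)
    on S T rewrite eqSub-refl (S ∪ T) =
      trans (rearrange (disjointB S T) _ _ _) (*-congˡ (sym (merge alt (λ i → i) S T)))

  annihilateˡ : ∀ {w} → Alternating w → ∀ x y →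
                (∀ u → ⟨ y , (λ t → w (u ++ t)) ⟩ ≈ 0#) → ⟨ x *E y , w ⟩ ≈ 0#
  annihilateˡ alt x y z = trans (pair-* alt x y) (sum-zero (allSubsets n) λ S →
    trans (sum-cong (allSubsets n) (λ T → *-assoc _ _ _))
    (trans (sym (sum-*ˡ (allSubsets n) (x S) _))
    (trans (*-congˡ (z (letters S))) (zeroʳ _))))

  annihilateʳ : ∀ {w} → Alternating w → ∀ x y →
                (∀ v → ⟨ x , (λ t → w (t ++ v)) ⟩ ≈ 0#) → ⟨ x *E y , w ⟩ ≈ 0#
  annihilateʳ alt x y z =
    trans (pair-* alt x y) (trans (sum-swap (allSubsets n) (allSubsets n) _)
    (sum-zero (allSubsets n) λ T →
    trans (sum-cong (allSubsets n) (λ S → trans (*-congʳ (*-comm _ _)) (*-assoc _ _ _)))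
    (trans (sym (sum-*ˡ (allSubsets n) (y T) _))
    (trans (*-congˡ (z (letters T))) (zeroʳ _)))))

  -- Basis elements multiplied on the left and right of `q` turn into a frame `u`, `v` around the
  -- words of `q`. Vanishing on a two-sided ideal is thereby reduced to framed functionals on its
  -- generators.
  annihilate : ∀ {w} → Alternating w → ∀ a q b →
               (∀ u v → ⟨ q , sandwich u v w ⟩ ≈ 0#) → ⟨ (a *E q) *E b , w ⟩ ≈ 0#
  annihilate alt a q b z =
    annihilateʳ alt (a *E q) b λ v → annihilateˡ (suffix v alt) a q λ u → z u v

  -- Boundaries of words

  -- The value of `w` at the boundary of a word: either the first letter is deleted, or it is kept
  -- and the boundary of the rest enters with a minus sign.
  altSum : ∀ {X} → Functional X → List X → Carrier
  altSum w []       = 0#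
  altSum w (x ∷ xs) = w xs + - altSum (λ t → w (x ∷ t)) xs

  altSum-cong : ∀ {X} {w w′ : Functional X} → (∀ t → w t ≈ w′ t) →
                ∀ xs → altSum w xs ≈ altSum w′ xs
  altSum-cong p []       = refl
  altSum-cong p (x ∷ xs) = +-cong (p xs) (-‿cong (altSum-cong (λ t → p (x ∷ t)) xs))

  altSum-zero : ∀ {X} {w : Functional X} xs →
                (∀ t → suc (length t) ≡ length xs → w t ≈ 0#) → altSum w xs ≈ 0#
  altSum-zero []       z = refl
  altSum-zero (x ∷ xs) z =
    trans (+-cong (z xs ≡.refl)
                  (trans (-‿cong (altSum-zero xs (λ t p → z (x ∷ t) (≡.cong suc p)))) -0#≈0#))
          (+-identityˡ 0#)

  -- The number `below S i` is the position of `i` in the word of `S`, so the signs of `∂e` are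
  -- those of `altSum`.
  sum-removals : ∀ {X m} (w : Functional X) (g : Fin m → X) S →
    sumL (indices m) (λ i → δ (lookup S i) (sign (below S i) * w (word g (S [ i ]≔ false)))) ≈
    altSum w (word g S)
  sum-removals w g []          = refl
  sum-removals w g (false ∷ S) =
    trans (+-identityˡ _)
    (trans (sum-indices-suc (λ i → δ (lookup (false ∷ S) i) (sign (below (false ∷ S) i) *
              w (word g ((false ∷ S) [ i ]≔ false)))))
           (sum-removals w (g ∘ suc) S))
  sum-removals {m = suc m} w g (true ∷ S) = +-cong (*-identityˡ _) (begin
    sumL (toList (tabulate Fin.suc)) (λ i → δ (lookup (true ∷ S) i)
        (sign (below (true ∷ S) i) * w (word g ((true ∷ S) [ i ]≔ false))))
      ≈⟨ sum-indices-suc (λ i → δ (lookup (true ∷ S) i)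
           (sign (below (true ∷ S) i) * w (word g ((true ∷ S) [ i ]≔ false)))) ⟩
    sumL (indices m) (λ i → δ (lookup S i) (- sign (below S i) * w′ i))
      ≈⟨ sum-cong (indices m) (λ i →
           trans (δ-cong (lookup S i) (sym (-‿distribˡ-* _ _))) (δ-neg (lookup S i) _)) ⟩
    sumL (indices m) (λ i → - δ (lookup S i) (sign (below S i) * w′ i))
      ≈⟨ sum-neg (indices m) (λ i → δ (lookup S i) (sign (below S i) * w′ i)) ⟩
    - sumL (indices m) (λ i → δ (lookup S i) (sign (below S i) * w′ i))
      ≈⟨ -‿cong (sum-removals (λ t → w (g zero ∷ t)) (g ∘ suc) S) ⟩
    - altSum (λ t → w (g zero ∷ t)) (word (g ∘ suc) S) ∎)
    where
    w′ : Fin m → Carrier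
    w′ i = w (g zero ∷ word (g ∘ suc) (S [ i ]≔ false))

  pair-∂e : ∀ S w → ⟨ ∂e S , w ⟩ ≈ altSum w (letters S)
  pair-∂e S w = begin
    sumL all (λ U → ∂e S U * w (letters U))
      ≈⟨ sum-cong all (λ U → sum-*ʳ ids _ _) ⟩
    sumL all (λ U → sumL ids (λ i → term i U * w (letters U)))
      ≈⟨ sum-swap all ids (λ U i → term i U * w (letters U)) ⟩
    sumL ids (λ i → sumL all (λ U → term i U * w (letters U)))
      ≈⟨ sum-cong ids (λ i → trans (sum-single (S - i) _ (off i)) (on i)) ⟩
    sumL ids (λ i → δ (lookup S i) (sign (below S i) * w (letters (S [ i ]≔ false))))
      ≈⟨ sum-removals w (λ i → i) S ⟩
    altSum w (letters S) ∎
    where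
    all = allSubsets n
    ids = indices n
    term : Fin n → Subset n → Carrier
    term i U = δ (lookup S i ∧ eqSub (S - i) U) (sign (below S i))
    off : ∀ i U → U ≢ S - i → term i U * w (letters U) ≈ 0#
    off i U U≢ rewrite ≢⇒eqSub (S - i) U (U≢ ∘ ≡.sym) | ∧-zeroʳ (lookup S i) = zeroˡ _
    δ-*ʳ : ∀ b r v → δ (b ∧ true) r * v ≈ δ b (r * v)
    δ-*ʳ true  r v = refl
    δ-*ʳ false r v = zeroˡ v
    on : ∀ i → term i (S - i) * w (letters (S - i)) ≈
               δ (lookup S i) (sign (below S i) * w (letters (S [ i ]≔ false)))
    on i rewrite eqSub-refl (S - i) | p-x≡p[x]≔false S i = δ-*ʳ (lookup S i) _ _

  -- Coefficient functionals

  -- The coefficient of e_S in the product of the letters, by expansion along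
  -- the first letter: e_i ∧ e_{S ∖ i} = (-1)^{below S i} e_S.
  coeff : ∀ {m} → List (Fin m) → Subset m → Carrier
  coeff []       S = δ (eqSub S ⊥) 1#
  coeff (i ∷ ws) S = δ (lookup S i) (sign (below S i) * coeff ws (S [ i ]≔ false))

  -- Removing the smaller index lowers the count below the larger one by one, while removing the
  -- larger leaves the other count alone. The two orders of removal hence differ by one sign.
  below-exchange : ∀ {m} (S : Subset m) i j → i ≢ j →
    lookup S i ≡ true → lookup S j ≡ true →
    sign (below S i) * sign (below (S [ i ]≔ false) j) ≈
    - (sign (below S j) * sign (below (S [ j ]≔ false) i))
  below-exchange S zero zero i≢j _ _ = contradiction ≡.refl i≢j
  below-exchange (true ∷ S) zero (suc j) _ _ _ = begin
    1# * sign (below S j)           ≈⟨ *-comm _ _ ⟩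
    sign (below S j) * 1#           ≈⟨ -‿involutive _ ⟨
    - (- (sign (below S j) * 1#))   ≈⟨ -‿cong (-‿distribˡ-* _ _) ⟩
    - (- sign (below S j) * 1#)     ∎
  below-exchange (true ∷ S) (suc i) zero _ _ _ = begin
    - sign (below S i) * 1#         ≈⟨ -‿distribˡ-* _ _ ⟨
    - (sign (below S i) * 1#)       ≈⟨ -‿cong (*-comm _ _) ⟩
    - (1# * sign (below S i))       ∎
  below-exchange (false ∷ S) (suc i) (suc j) i≢j Si Sj =
    below-exchange S i j (i≢j ∘ ≡.cong suc) Si Sj
  below-exchange (true ∷ S) (suc i) (suc j) i≢j Si Sj = begin
    - sign (below S i) * - sign (below (S [ i ]≔ false) j)
      ≈⟨ neg*neg _ _ ⟩
    sign (below S i) * sign (below (S [ i ]≔ false) j)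
      ≈⟨ below-exchange S i j (i≢j ∘ ≡.cong suc) Si Sj ⟩
    - (sign (below S j) * sign (below (S [ j ]≔ false) i))
      ≈⟨ -‿cong (neg*neg _ _) ⟨
    - (- sign (below S j) * - sign (below (S [ j ]≔ false) i)) ∎
    where
    neg*neg : ∀ r s → - r * - s ≈ r * s
    neg*neg r s = trans (sym (-‿distribˡ-* r (- s)))
                  (trans (-‿cong (sym (-‿distribʳ-* r s))) (-‿involutive _))

  -- The first `i` clears its bit in the subset, and the second one then finds it false.
  coeff-repeat : ∀ {m} (S : Subset m) u i v → coeff (u ++ i ∷ i ∷ v) S ≈ 0#
  coeff-repeat S []      i v rewrite lookup∘update i S false =
    δ-zero (lookup S i) (zeroʳ _)
  coeff-repeat S (x ∷ u) i v =
    δ-zero (lookup S x) (trans (*-congˡ (coeff-repeat _ u i v)) (zeroʳ _))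

  coeff-swap : ∀ {m} (S : Subset m) u i j v →
               coeff (u ++ i ∷ j ∷ v) S ≈ - coeff (u ++ j ∷ i ∷ v) S
  coeff-swap S (x ∷ u) i j v = begin
    δ (lookup S x) (sign (below S x) * coeff (u ++ i ∷ j ∷ v) S′)
      ≈⟨ δ-cong (lookup S x) (trans (*-congˡ (coeff-swap S′ u i j v)) (sym (-‿distribʳ-* _ _))) ⟩
    δ (lookup S x) (- (sign (below S x) * coeff (u ++ j ∷ i ∷ v) S′))
      ≈⟨ δ-neg (lookup S x) _ ⟩
    - δ (lookup S x) (sign (below S x) * coeff (u ++ j ∷ i ∷ v) S′) ∎
    where S′ = S [ x ]≔ false
  coeff-swap S [] i j v with i Fin.≟ j
  ... | yes ≡.refl = trans (coeff-repeat S [] i v)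
                           (trans (sym -0#≈0#) (-‿cong (sym (coeff-repeat S [] i v))))
  ... | no i≢j rewrite lookup∘update′ i≢j S false | lookup∘update′ (i≢j ∘ ≡.sym) S false
                     | []≔-commutes {x = false} {y = false} S i j i≢j
    with lookup S i in Si | lookup S j in Sj
  ... | false | false = sym -0#≈0#
  ... | false | true  = trans (sym -0#≈0#) (-‿cong (sym (zeroʳ _)))
  ... | true  | false = trans (zeroʳ _) (sym -0#≈0#)
  ... | true  | true  = begin
    sign (below S i) * (sign (below (S [ i ]≔ false) j) * rest)
      ≈⟨ *-assoc _ _ _ ⟨
    sign (below S i) * sign (below (S [ i ]≔ false) j) * rest
      ≈⟨ *-congʳ (below-exchange S i j i≢j Si Sj) ⟩
    - (sign (below S j) * sign (below (S [ j ]≔ false) i)) * rest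
      ≈⟨ -‿distribˡ-* _ _ ⟨
    - (sign (below S j) * sign (below (S [ j ]≔ false) i) * rest)
      ≈⟨ -‿cong (*-assoc _ _ _) ⟩
    - (sign (below S j) * (sign (below (S [ j ]≔ false) i) * rest)) ∎
    where rest = coeff v ((S [ j ]≔ false) [ i ]≔ false)

  coeff-alternating : ∀ {m} (S : Subset m) → Alternating (λ t → coeff t S)
  coeff-alternating S .swap   = coeff-swap S
  coeff-alternating S .repeat = coeff-repeat S

  coeff-map-suc : ∀ {m} ws (S : Subset m) →
                  coeff (List.map suc ws) (false ∷ S) ≈ coeff ws S
  coeff-map-suc []       S = refl
  coeff-map-suc (i ∷ ws) S =
    δ-cong (lookup S i) (*-congˡ (coeff-map-suc ws (S [ i ]≔ false)))

  -- No letter removes index 0, so the subset left at the end of the expansion is not empty.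
  coeff-unused : ∀ {m} ws (S : Subset m) → coeff (List.map suc ws) (true ∷ S) ≈ 0#
  coeff-unused []       S = refl
  coeff-unused (i ∷ ws) S =
    δ-zero (lookup S i) (trans (*-congˡ (coeff-unused ws (S [ i ]≔ false))) (zeroʳ _))

  coeff-letters : ∀ {m} (T S : Subset m) → coeff (letters T) S ≈ δ (eqSub T S) 1#
  coeff-letters []          []          = refl
  coeff-letters (true ∷ T)  (false ∷ S) = refl
  coeff-letters (true ∷ T)  (true ∷ S)  rewrite word-suc T =
    trans (*-identityˡ _) (trans (coeff-map-suc (letters T) S) (coeff-letters T S))
  coeff-letters (false ∷ T) (true ∷ S)  rewrite word-suc T =
    coeff-unused (letters T) S
  coeff-letters (false ∷ T) (false ∷ S) rewrite word-suc T =
    trans (coeff-map-suc (letters T) S) (coeff-letters T S)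

  -- Unless the expansion meets a false bit, the word is an arrangement of `S`. Only the resulting
  -- equality of additive weights is kept, as triangularity is argued by weight.
  coeff-support : ∀ {m} (f : Fin m → ℕ) ws S →
                  coeff ws S ≈ 0# ⊎ sum (List.map f ws) ≡ sum (word f S)
  coeff-support f [] S with eqSub S ⊥ in eq
  ... | false = inj₁ refl
  ... | true  rewrite eqSub⇒≡ S ⊥ eq | word-⊥ f = inj₂ ≡.refl
  coeff-support f (i ∷ ws) S with lookup S i in Si
  ... | false = inj₁ refl
  ... | true with coeff-support f ws (S [ i ]≔ false)
  ...   | inj₁ z = inj₁ (trans (*-congˡ z) (zeroʳ _))
  ...   | inj₂ p = inj₂ (≡.trans (≡.cong (f i ℕ.+_) p) (≡.sym (sum-remove f S i Si)))

  -- Triples with two equal letters, and truncation to degree two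

  AnyTwoEqual : ∀ {X : Set} → X → X → X → Set
  AnyTwoEqual a b c = a ≡ b ⊎ a ≡ c ⊎ b ≡ c

  -- Deleting one or the other of the equal letters gives two terms that cancel; deleting the third
  -- letter leaves a repetition.
  altSum-two-equal : ∀ {X} {w : Functional X} → Alternating w → ∀ {a b c} →
                     AnyTwoEqual a b c → altSum w (a ∷ b ∷ c ∷ []) ≈ 0#
  altSum-two-equal {w = w} alt {a} {b} {c} two = begin
    w (b ∷ c ∷ []) + - (w (a ∷ c ∷ []) + - (w (a ∷ b ∷ []) + - 0#))
      ≈⟨ +-congˡ (-‿+-comm _ _) ⟨
    w (b ∷ c ∷ []) + (- w (a ∷ c ∷ []) + - - (w (a ∷ b ∷ []) + - 0#))
      ≈⟨ +-congˡ (+-congˡ (trans (-‿involutive _) (trans (+-congˡ -0#≈0#) (+-identityʳ _)))) ⟩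
    w (b ∷ c ∷ []) + (- w (a ∷ c ∷ []) + w (a ∷ b ∷ []))
      ≈⟨ cancel two ⟩
    0# ∎
    where
    cancel : AnyTwoEqual a b c →
             w (b ∷ c ∷ []) + (- w (a ∷ c ∷ []) + w (a ∷ b ∷ [])) ≈ 0#
    cancel (inj₁ ≡.refl) =
      trans (+-congˡ (trans (+-congˡ (repeat alt [] a [])) (+-identityʳ _))) (-‿inverseʳ _)
    cancel (inj₂ (inj₁ ≡.refl)) =
      trans (+-cong (swap alt [] b a [])
                    (trans (+-congʳ (trans (-‿cong (repeat alt [] a [])) -0#≈0#)) (+-identityˡ _)))
            (-‿inverseˡ _)
    cancel (inj₂ (inj₂ ≡.refl)) =
      trans (+-congʳ (repeat alt [] b [])) (trans (+-identityˡ _) (-‿inverseˡ _))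

  -- Pairing with truncate w reads off the degree-two component.
  truncate : ∀ {X} → Functional X → Functional X
  truncate w t = δ (does (length t ℕ.≟ 2)) (w t)

  truncate-≢ : ∀ {X} (w : Functional X) t → length t ≢ 2 → truncate w t ≈ 0#
  truncate-≢ w t l≢2 rewrite dec-false (length t ℕ.≟ 2) l≢2 = refl

  truncate-≡ : ∀ {X} (w : Functional X) t → length t ≡ 2 → truncate w t ≈ w t
  truncate-≡ w t l≡2 rewrite dec-true (length t ℕ.≟ 2) l≡2 = refl

  truncate-alternating : ∀ {X} {w : Functional X} → Alternating w → Alternating (truncate w)
  truncate-alternating alt .swap u i j v
    rewrite length-++ u {i ∷ j ∷ v} | length-++ u {j ∷ i ∷ v} =
    trans (δ-cong b (swap alt u i j v)) (δ-neg b _)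
    where b = does (length u ℕ.+ suc (suc (length v)) ℕ.≟ 2)
  truncate-alternating alt .repeat u i v =
    δ-zero (does (length (u ++ i ∷ i ∷ v) ℕ.≟ 2)) (repeat alt u i v)

  Triple : Set
  Triple = Fin n × Fin n × Fin n

  Kills : Functional (Fin n) → List Triple → Set ℓ
  Kills w = All λ (a , b , c) → altSum w (a ∷ b ∷ c ∷ []) ≈ 0#

  -- Functionals vanishing on the ideals

  module Annihilation (G : Matroid n) (loopless : Loopless G) (simple : NoMultiplePoints G) where
    open Matroid G

    -- Stated through line-closed sets because it serves to place the span with respect to a list of
    -- triples inside `lc`.
    Collinear : Triple → Set
    Collinear t = ∀ T → LineClosed G T → ClosedUnder T t

    pair-indep : ∀ i j → Indep (⁅ i ⁆ ∪ ⁅ j ⁆)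
    pair-indep i j with i Fin.≟ j
    ... | yes ≡.refl = ≡.subst Indep (≡.sym (∪-idem ⁅ i ⁆)) (loopless i)
    ... | no i≢j     = simple i j i≢j

    -- Any two points are independent, by simplicity, so in a dependent triple each point lies in
    -- the closure of the other two.
    dependent⇒collinear : ∀ S {a b c} → Dependent G S → letters S ≡ a ∷ b ∷ c ∷ [] →
                          Collinear (a , b , c)
    dependent⇒collinear S {a} {b} {c} dep eq T closed =
      third a b c (λ p → p) ,
      third a c b (λ { (here p)                 → here p
                     ; (there (here p))         → there (there (here p))
                     ; (there (there (here p))) → there (here p) }) ,
      third b c a (λ { (here p)                 → there (there (here p))
                     ; (there (here p))         → here p
                     ; (there (there (here p))) → there (here p) })
      where
      third : ∀ i j k → (∀ {x} → x ∈ₗ a ∷ b ∷ c ∷ [] → x ∈ₗ i ∷ j ∷ k ∷ []) →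
              i ∈ T → j ∈ T → k ∈ T
      third i j k perm i∈T j∈T =
        closed i j k i∈T j∈T (inj₂ (⁅ i ⁆ ∪ ⁅ j ⁆ , (λ p → p) , pair-indep i j ,
          λ indep → dep (indep-⊆ S⊆ indep)))
        where
        S⊆ : S ⊆ (⁅ i ⁆ ∪ ⁅ j ⁆) ∪ ⁅ k ⁆
        S⊆ {x} x∈S with perm (≡.subst (x ∈ₗ_) eq (∈-letters x∈S))
        ... | here ≡.refl                 = x∈p∪q⁺ (inj₁ (x∈p∪q⁺ (inj₁ (x∈⁅x⁆ x))))
        ... | there (here ≡.refl)         = x∈p∪q⁺ (inj₁ (x∈p∪q⁺ (inj₂ (x∈⁅x⁆ x))))
        ... | there (there (here ≡.refl)) = x∈p∪q⁺ (inj₂ (x∈⁅x⁆ x))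

    ¬dependent-pair : ∀ S {a b} → (∀ {x} → x ∈ₗ letters S → x ∈ₗ a ∷ b ∷ []) → ¬ Dependent G S
    ¬dependent-pair S {a} {b} sub dep = dep (indep-⊆ S⊆ (pair-indep a b))
      where
      S⊆ : S ⊆ ⁅ a ⁆ ∪ ⁅ b ⁆
      S⊆ {x} x∈S with sub (∈-letters x∈S)
      ... | here ≡.refl         = x∈p∪q⁺ (inj₁ (x∈⁅x⁆ x))
      ... | there (here ≡.refl) = x∈p∪q⁺ (inj₂ (x∈⁅x⁆ x))

    -- Dependent sets have at least three elements. The boundary of a triple has degree two and
    -- survives truncation only in the empty frame; larger sets have boundaries of degree at least
    -- three. The word `xs` is separate from `letters S` to allow cases on its length.
    truncated-altSum : ∀ S → Dependent G S → ∀ xs → letters S ≡ xs →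
      ∃ λ D → All Collinear D × (∀ w → Kills w D →
        ∀ u v → altSum (sandwich u v (truncate w)) xs ≈ 0#)
    truncated-altSum S dep [] eq = [] , [] , λ _ _ _ _ → refl
    truncated-altSum S dep (a ∷ []) eq =
      -- A singleton is treated as a pair with equal entries.
      contradiction dep (¬dependent-pair S {a} {a} λ {x} x∈ →
        duplicate (≡.subst (x ∈ₗ_) eq x∈))
      where
      duplicate : ∀ {x} → x ∈ₗ a ∷ [] → x ∈ₗ a ∷ a ∷ []
      duplicate (here p) = here p
    truncated-altSum S dep (a ∷ b ∷ []) eq =
      contradiction dep (¬dependent-pair S λ {x} x∈ → ≡.subst (x ∈ₗ_) eq x∈)
    truncated-altSum S dep (a ∷ b ∷ c ∷ []) eq =
      (a , b , c) ∷ [] , dependent⇒collinear S dep eq ∷ [] , vanish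
      where
      vanish : ∀ w → Kills w ((a , b , c) ∷ []) →
               ∀ u v → altSum (sandwich u v (truncate w)) (a ∷ b ∷ c ∷ []) ≈ 0#
      -- On the two-letter words that occur here, `truncate w` computes to `w`.
      vanish w (k ∷ []) [] [] = k
      vanish w _ (y ∷ u) v = altSum-zero (a ∷ b ∷ c ∷ []) λ t l → truncate-≢ w ((y ∷ u ++ t) ++ v)
        (long-sandwich (y ∷ u) t v (s≤s (ℕₚ.≤-trans (ℕₚ.≤-reflexive (≡.cong ℕ.pred (≡.sym l)))
          (ℕₚ.≤-trans (ℕₚ.m≤n+m (length t) (length u)) (ℕₚ.m≤m+n _ (length v))))))
      vanish w _ [] (y ∷ v) = altSum-zero (a ∷ b ∷ c ∷ []) λ t l → truncate-≢ w (t ++ y ∷ v)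
        (long-sandwich [] t (y ∷ v) (ℕₚ.≤-trans (ℕₚ.≤-reflexive (≡.sym l))
          (ℕₚ.≤-trans (s≤s (ℕₚ.m≤m+n (length t) (length v)))
            (ℕₚ.≤-reflexive (≡.sym (ℕₚ.+-suc (length t) (length v)))))))
    truncated-altSum S dep (a ∷ b ∷ c ∷ d ∷ xs) eq =
      [] , [] , λ w _ u v → altSum-zero (a ∷ b ∷ c ∷ d ∷ xs) λ t l →
        truncate-≢ w ((u ++ t) ++ v) (long-sandwich u t v
          (ℕₚ.≤-trans (s≤s (s≤s (s≤s z≤n)))
          (ℕₚ.≤-trans (ℕₚ.≤-reflexive (≡.cong ℕ.pred (≡.sym l)))
          (ℕₚ.≤-trans (ℕₚ.m≤n+m (length t) (length u)) (ℕₚ.m≤m+n _ (length v))))))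

    -- A derivation uses finitely many generators; `D` collects the dependent triples among them and
    -- is fixed before `w` is chosen.
    certify-I : ∀ {x} → InI G x → ∃ λ D → All Collinear D ×
      (∀ w → Alternating w → Kills w D → ⟨ x , truncate w ⟩ ≈ 0#)
    certify-I (gen a q b (S , dep , q≋∂e)) =
      let D , coll , vanish = truncated-altSum S dep (letters S) ≡.refl in
      D , coll , λ w alt kills → annihilate (truncate-alternating alt) a q b λ u v →
        trans (pair-resp (sandwich u v (truncate w)) q≋∂e)
        (trans (pair-∂e S (sandwich u v (truncate w))) (vanish w kills u v))
    certify-I zro = [] , [] , λ w _ _ → pair-0 (truncate w)
    certify-I (add {x} {y} p q) =
      let D₁ , coll₁ , v₁ = certify-I p
          D₂ , coll₂ , v₂ = certify-I q
      in D₁ ++ D₂ , Allₚ.++⁺ coll₁ coll₂ , λ w alt kills →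
        trans (pair-+ x y (truncate w))
        (trans (+-cong (v₁ w alt (Allₚ.++⁻ˡ D₁ kills)) (v₂ w alt (Allₚ.++⁻ʳ D₁ kills)))
        (+-identityˡ 0#))
    certify-I (resp x≋y p) =
      let D , coll , v = certify-I p in
      D , coll , λ w alt kills →
        trans (pair-resp (truncate w) (λ U → sym (x≋y U))) (v w alt kills)

    truncate-homogeneous : ∀ {q} w → HomogDeg2 q → ⟨ q , w ⟩ ≈ ⟨ q , truncate w ⟩
    truncate-homogeneous {q} w homog = sum-cong (allSubsets n) term
      where
      term : ∀ U → q U * w (letters U) ≈ q U * truncate w (letters U)
      term U with ∣ U ∣ ℕ.≟ 2
      ... | yes two = *-congˡ (sym (truncate-≡ w (letters U) (≡.trans (length-word _ U) two)))
      ... | no ¬two = trans (trans (*-congʳ (homog U ¬two)) (zeroˡ _))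
                            (sym (trans (*-congʳ (homog U ¬two)) (zeroˡ _)))

    -- On a homogeneous generator `w` and its truncation agree, so `certify-I` applies to each
    -- framed functional. This is why the triples must be killed in every frame.
    certify-J : ∀ {x} → InJ G x → ∃ λ D → All Collinear D ×
      (∀ w → Alternating w → (∀ u v → Kills (sandwich u v w) D) → ⟨ x , w ⟩ ≈ 0#)
    certify-J (gen a q b (q∈I , homog)) =
      let D , coll , vanish = certify-I q∈I in
      D , coll , λ w alt kills → annihilate alt a q b λ u v →
        trans (truncate-homogeneous (sandwich u v w) homog)
              (vanish (sandwich u v w) (sandwich-alternating u v alt) (kills u v))
    certify-J zro = [] , [] , λ w _ _ → pair-0 w
    certify-J (add {x} {y} p q) =
      let D₁ , coll₁ , v₁ = certify-J p
          D₂ , coll₂ , v₂ = certify-J q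
      in D₁ ++ D₂ , Allₚ.++⁺ coll₁ coll₂ , λ w alt kills →
        trans (pair-+ x y w)
        (trans (+-cong (v₁ w alt (λ u v → Allₚ.++⁻ˡ D₁ (kills u v)))
                       (v₂ w alt (λ u v → Allₚ.++⁻ʳ D₁ (kills u v))))
        (+-identityˡ 0#))
    certify-J (resp x≋y p) =
      let D , coll , v = certify-J p in
      D , coll , λ w alt kills →
        trans (pair-resp w (λ U → sym (x≋y U))) (v w alt kills)

-- Tails of a subset, and greatest indices

∈-tailFrom⁺ : ∀ {n} (G : Matroid n) {S i j} → j ∈ S → i Fin.≤ j → j ∈ tailFrom G S i
∈-tailFrom⁺ G {S} {i} {j} j∈S i≤j = lookup⇒[]= j _
  (≡.trans (lookup∘tabulate _ j)
    (≡.cong₂ _∧_ ([]=⇒lookup j∈S) (Equivalence.to T-≡ (ℕₚ.≤⇒≤ᵇ i≤j))))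

∈-tailFrom⁻ : ∀ {n} (G : Matroid n) {S i j} → j ∈ tailFrom G S i → j ∈ S × i Fin.≤ j
∈-tailFrom⁻ G {S} {i} {j} j∈ =
  let Sj , i≤ᵇj = Equivalence.to T-∧ (Equivalence.from T-≡
        (≡.trans (≡.sym (lookup∘tabulate _ j)) ([]=⇒lookup j∈)))
  in lookup⇒[]= j S (Equivalence.to T-≡ Sj) , ℕₚ.≤ᵇ⇒≤ (toℕ i) (toℕ j) i≤ᵇj

tailFrom-antitone : ∀ {n} (G : Matroid n) {S i j} → i Fin.≤ j → tailFrom G S j ⊆ tailFrom G S i
tailFrom-antitone G {S} i≤j x∈ =
  let x∈S , j≤x = ∈-tailFrom⁻ G {S} x∈ in ∈-tailFrom⁺ G x∈S (ℕₚ.≤-trans i≤j j≤x)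

greatest : ∀ {m} {P : Fin m → Set} → Decidable P → ∀ i → P i →
           ∃ λ l → P l × (∀ k → P k → k Fin.≤ l)
greatest {suc m} {P} P? i Pi with Finₚ.any? (P? ∘ suc)
... | yes (j , Pj) =
  let l , Pl , max = greatest (P? ∘ suc) j Pj in
  suc l , Pl , λ { zero _ → z≤n ; (suc k) Pk → s≤s (max k Pk) }
... | no ¬P = zero , P-zero i Pi , λ { zero _ → z≤n ; (suc k) Pk → contradiction (k , Pk) ¬P }
  where
  P-zero : ∀ i → P i → P zero
  P-zero zero    p = p
  P-zero (suc k) p = contradiction (k , p) ¬P

-- Span with respect to a list of triples, and the flag of a subset

module Span {n} (G : Matroid n) (D : List (Fin n × Fin n × Fin n)) where

  Closed : Subset n → Set
  Closed T = All (ClosedUnder T) D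

  closed? : Decidable Closed
  closed? T = All.all? (λ (a , b , c) →
    (a ∈? T →-dec b ∈? T →-dec c ∈? T) ×-dec
    (a ∈? T →-dec c ∈? T →-dec b ∈? T) ×-dec
    (b ∈? T →-dec c ∈? T →-dec a ∈? T)) D

  Spans : Subset n → Fin n → Set
  Spans S j = ∀ T → Closed T → S ⊆ T → j ∈ T

  spans? : ∀ S → Decidable (Spans S)
  spans? S j with anySubset? (λ T → closed? T ×-dec S ⊆? T ×-dec ¬? (j ∈? T))
  ... | yes (T , closed , S⊆T , j∉T) = no λ spans → j∉T (spans T closed S⊆T)
  -- The failed search only refutes `j ∉ T`; decidable membership turns this into `j ∈ T`.
  ... | no ∄ = yes λ T closed S⊆T → decidable-stable (j ∈? T) λ j∉T →
    ∄ (T , closed , (λ {x} → S⊆T {x}) , j∉T)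

  spans-mono : ∀ {S T j} → S ⊆ T → Spans S j → Spans T j
  spans-mono S⊆T spans U closed T⊆U = spans U closed (λ x∈S → T⊆U (S⊆T x∈S))

  NBBᴰ : Subset n → Set
  NBBᴰ S = ∀ i → i ∈ S → ∀ j → Spans (tailFrom G S i) j → i Fin.≤ j

  nbbᴰ? : Decidable NBBᴰ
  nbbᴰ? S = Finₚ.all? λ i → (i ∈? S) →-dec
            Finₚ.all? λ j → spans? (tailFrom G S i) j →-dec (i Fin.≤? j)

  -- Index 0 stands for the whole ground set, so that points outside the span
  -- of S get level 0; index i + 1 belongs to the element i of S.
  InFlag : Subset n → Fin n → Fin (suc n) → Set
  InFlag S j zero    = ⊤
  InFlag S j (suc i) = i ∈ S × Spans (tailFrom G S i) j

  inFlag? : ∀ S j → Decidable (InFlag S j)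
  inFlag? S j zero    = yes _
  inFlag? S j (suc i) = (i ∈? S) ×-dec spans? (tailFrom G S i) j

  deepest : ∀ S j → ∃ λ l → InFlag S j l × (∀ k → InFlag S j k → k Fin.≤ l)
  deepest S j = greatest (inFlag? S j) zero _

  level : Subset n → Fin n → Fin (suc n)
  level S j = proj₁ (deepest S j)

  -- If `j` has level `suc i`, it lies in the span of the tail from `i`, whose minimum is `i`.
  level-≤ : ∀ {S} → NBBᴰ S → ∀ j → level S j Fin.≤ Fin.suc j
  level-≤ {S} nbb j with deepest S j
  ... | zero  , _                 , _ = z≤n
  ... | suc i , (i∈S , j-spanned) , _ = s≤s (nbb i i∈S j j-spanned)

  level-∈ : ∀ {S} → NBBᴰ S → ∀ {j} → j ∈ S → level S j ≡ suc j
  level-∈ {S} nbb {j} j∈S = Finₚ.≤-antisym (level-≤ nbb j)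
    (proj₂ (proj₂ (deepest S j)) (suc j)
      (j∈S , λ T _ tail⊆T → tail⊆T (∈-tailFrom⁺ G j∈S ℕₚ.≤-refl)))

  -- Tails shrink as their starting index grows, so the flag member that gives `a` its level also
  -- contains `b`, and hence `c`.
  level-closed : ∀ S {a b c} →
    (∀ {T} → Closed T → a ∈ T → b ∈ T → c ∈ T) →
    level S a Fin.≤ level S b → level S a Fin.≤ level S c
  level-closed S {a} {b} {c} closed a≤b with deepest S a | deepest S b
  ... | zero  , _                 , _ | _ = z≤n
  level-closed S {a} {b} {c} closed (s≤s i≤k)
    | suc i , (i∈S , a-spanned) , _ | suc k , (_ , b-spanned) , _ =
    proj₂ (proj₂ (deepest S c)) (suc i)
      (i∈S , λ T cl tail⊆T → closed cl (a-spanned T cl tail⊆T)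
               (spans-mono (tailFrom-antitone G {S} i≤k) b-spanned T cl tail⊆T))

  -- The two smallest of the three levels agree.
  level-two-equal : ∀ S {a b c} → (a , b , c) ∈ₗ D →
    level S a ≡ level S b ⊎ level S a ≡ level S c ⊎ level S b ≡ level S c
  level-two-equal S {a} {b} {c} abc∈D =
    two-smallest (Finₚ.≤-total (level S a) (level S b))
    where
    rule : ∀ {T} → Closed T → ClosedUnder T (a , b , c)
    rule closed = All.lookup closed abc∈D
    ab⇒c : ∀ {T} → Closed T → a ∈ T → b ∈ T → c ∈ T
    ab⇒c cl = proj₁ (rule cl)
    ac⇒b : ∀ {T} → Closed T → a ∈ T → c ∈ T → b ∈ T
    ac⇒b cl = proj₁ (proj₂ (rule cl))
    bc⇒a : ∀ {T} → Closed T → b ∈ T → c ∈ T → a ∈ T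
    bc⇒a cl = proj₂ (proj₂ (rule cl))
    two-smallest : level S a Fin.≤ level S b ⊎ level S b Fin.≤ level S a →
                   level S a ≡ level S b ⊎ level S a ≡ level S c ⊎ level S b ≡ level S c
    two-smallest (inj₁ a≤b) with Finₚ.≤-total (level S b) (level S c)
    ... | inj₁ b≤c = inj₁ (Finₚ.≤-antisym a≤b (level-closed S bc⇒a b≤c))
    ... | inj₂ c≤b = inj₂ (inj₁ (Finₚ.≤-antisym (level-closed S ab⇒c a≤b)
                                  (level-closed S (λ cl p q → bc⇒a cl q p) c≤b)))
    two-smallest (inj₂ b≤a) with Finₚ.≤-total (level S a) (level S c)
    ... | inj₁ a≤c = inj₁ (Finₚ.≤-antisym (level-closed S ac⇒b a≤c) b≤a)
    ... | inj₂ c≤a = inj₂ (inj₂ (Finₚ.≤-antisym (level-closed S (λ cl p q → ab⇒c cl q p) b≤a)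
                                  (level-closed S (λ cl p q → ac⇒b cl q p) c≤a)))

-- Weights by reversed index

-- Levels only lower an index and so only raise its depth. With the order reversed, the induction
-- runs upwards in `coweight`. The subtraction never truncates, since `toℕ l` is at most `n`.
depth : ∀ {n} → Fin (suc n) → ℕ
depth {n} l = n ℕ.∸ toℕ l

coweight : ∀ {n} → Subset n → ℕ
coweight = sum ∘ word (depth ∘ suc)

depth-injective : ∀ {n} {k l : Fin (suc n)} → depth k ≡ depth l → k ≡ l
depth-injective {k = k} {l} eq =
  Finₚ.toℕ-injective (ℕₚ.∸-cancelˡ-≡ (Finₚ.toℕ≤pred[n] k) (Finₚ.toℕ≤pred[n] l) eq)

sum-map-mono : ∀ {A : Set} {f g : A → ℕ} → (∀ x → f x ℕ.≤ g x) → ∀ xs →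
               sum (List.map f xs) ℕ.≤ sum (List.map g xs)
sum-map-mono f≤g []       = z≤n
sum-map-mono f≤g (x ∷ xs) = ℕₚ.+-mono-≤ (f≤g x) (sum-map-mono f≤g xs)

sum-map-rigid : ∀ {A : Set} {f g : A → ℕ} → (∀ x → f x ℕ.≤ g x) → ∀ xs →
  sum (List.map g xs) ℕ.≤ sum (List.map f xs) → All (λ x → f x ≡ g x) xs
sum-map-rigid f≤g []       _ = []
sum-map-rigid {f = f} {g} f≤g (x ∷ xs) le =
  ℕₚ.≤-antisym (f≤g x)
    (ℕₚ.+-cancelʳ-≤ (sum (List.map f xs)) _ _
      (ℕₚ.≤-trans (ℕₚ.+-monoʳ-≤ (g x) (sum-map-mono f≤g xs)) le)) ∷
  sum-map-rigid f≤g xs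
    (ℕₚ.+-cancelˡ-≤ (f x) _ _
      (ℕₚ.≤-trans (ℕₚ.+-monoˡ-≤ (sum (List.map g xs)) (f≤g x)) le))

-- Dual functionals and triangularity

module Independence {c ℓ} (R : CommutativeRing c ℓ) {n : ℕ} (G : Matroid n)
                    (loopless : Loopless G) (simple : NoMultiplePoints G) where
  open CommutativeRing R hiding (zero; _-_)
  open Exterior R n
  open Functionals R n
  open Annihilation G loopless simple

  module _ {D} (collinear : All Collinear D) where
    open Span G D

    -- Line-closed sets are closed under the collinear triples of `D`, so the span is contained in
    -- `lc`.
    NBB⇒NBBᴰ : ∀ {S} → NBB G S → NBBᴰ S
    NBB⇒NBBᴰ nbb i i∈S j spans = nbb i i∈S j λ T closed tail⊆T →
      spans T (All.map (λ col → col T closed) collinear) tail⊆T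

    -- The leading `false` excludes level 0: a word with a letter outside the span of `S` gets the
    -- value zero, as if that letter were sent to 0.
    dual : Subset n → Functional (Fin n)
    dual S t = coeff (List.map (level S) t) (false ∷ S)

    dual-alternating : ∀ S → Alternating (dual S)
    dual-alternating S = pullback-alternating (level S) (coeff-alternating (false ∷ S))

    dual-kills : ∀ S u v → Kills (sandwich u v (dual S)) D
    dual-kills S u v = All.tabulate λ {(a , b , c)} abc∈D →
      trans (altSum-cong map-sandwich (a ∷ b ∷ c ∷ []))
            (altSum-two-equal (sandwich-alternating (List.map (level S) u) (List.map (level S) v)
                                (coeff-alternating (false ∷ S)))
                              (level-two-equal S abc∈D))
      where
      map-sandwich : ∀ t → sandwich u v (dual S) t ≈
        sandwich (List.map (level S) u) (List.map (level S) v)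
                 (λ t → coeff t (false ∷ S)) (List.map (level S) t)
      map-sandwich t = reflexive (≡.cong (λ t → coeff t (false ∷ S))
        (≡.trans (map-++ (level S) (u ++ t) v)
                 (≡.cong (_++ List.map (level S) v) (map-++ (level S) u t))))

    dual-fixed : ∀ S T → List.map (level S) (letters T) ≡ List.map suc (letters T) →
                 dual S (letters T) ≈ δ (eqSub T S) 1#
    dual-fixed S T eq = trans (reflexive (≡.cong (λ t → coeff t (false ∷ S)) eq))
      (trans (coeff-map-suc (letters T) S) (coeff-letters T S))

    dual-self : ∀ {S} → NBBᴰ S → dual S (letters S) ≈ 1#
    dual-self {S} nbb = trans
      (dual-fixed S S (map-cong-local (all-word (λ i → i) S (level-∈ nbb))))
      (reflexive (≡.cong (λ b → δ b 1#) (eqSub-refl S)))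

    -- Unless the value is zero, the levels of the letters of `T` have total depth `coweight S`.
    -- This total is at least `coweight T`, so equality holds at every letter; all letters are then
    -- fixed and the value is the coefficient of `e_S` in `e_T`.
    dual-triangular : ∀ {S} → NBBᴰ S → ∀ T → T ≢ S →
                      coweight S ℕ.≤ coweight T → dual S (letters T) ≈ 0#
    dual-triangular {S} nbb T T≢S S≤T
      with coeff-support depth (List.map (level S) (letters T)) (false ∷ S)
    ... | inj₁ z  = z
    ... | inj₂ eq = trans
      (dual-fixed S T (map-cong-local (All.map (≡.sym ∘ depth-injective) rigid)))
      (reflexive (≡.cong (λ b → δ b 1#) (≢⇒eqSub T S T≢S)))
      where
      rigid : All (λ t → depth (Fin.suc t) ≡ depth (level S t)) (letters T)
      rigid = sum-map-rigid (λ t → ℕₚ.∸-monoʳ-≤ n (level-≤ nbb t)) (letters T)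
        (ℕₚ.≤-trans (ℕₚ.≤-reflexive (≡.trans (≡.cong sum (map-∘ (letters T))) eq))
          (ℕₚ.≤-trans S≤T (ℕₚ.≤-reflexive (≡.cong sum (≡.sym (map-word (depth ∘ suc) (λ i → i) T))))))

    -- In the pairing with `dual S`, terms of smaller coweight vanish by induction and the remaining
    -- `T ≢ S` by triangularity, which leaves `x S`.
    coefficients-vanish : ∀ x → (∀ S → ¬ NBB G S → x S ≈ 0#) →
      (∀ S → ⟨ x , dual S ⟩ ≈ 0#) → ∀ S → x S ≈ 0#
    coefficients-vanish x support orthogonal =
      wfRec (λ S → x S ≈ 0#) step
      where
      open WF.All (On.wellFounded coweight <-wellFounded) ℓ
      step : ∀ S → (∀ {T} → coweight T ℕ.< coweight S → x T ≈ 0#) → x S ≈ 0#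
      -- The case distinction is on the decidable `NBBᴰ`; where it fails, `NBB` fails too and the
      -- support hypothesis applies.
      step S ih with nbbᴰ? S
      ... | no ¬nbb = support S (¬nbb ∘ NBB⇒NBBᴰ)
      ... | yes nbb = trans (sym (*-identityʳ (x S)))
        (trans (*-congˡ (sym (dual-self nbb)))
        (trans (sym (sum-single S _ others)) (orthogonal S)))
        where
        others : ∀ T → T ≢ S → x T * dual S (letters T) ≈ 0#
        others T T≢S with coweight T ℕ.<? coweight S
        ... | yes T<S = trans (*-congʳ (ih T<S)) (zeroˡ _)
        ... | no T≮S  = trans (*-congˡ (dual-triangular nbb T T≢S (ℕₚ.≮⇒≥ T≮S))) (zeroʳ _)

theorem2p16 : ∀ {c ℓ} (R : CommutativeRing c ℓ) (n : ℕ) (G : Matroid n) →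
    Loopless G → NoMultiplePoints G →
    (x : Exterior.Elem R n) →
    (∀ S → ¬ NBB G S → CommutativeRing._≈_ R (x S) (CommutativeRing.0# R)) →
    Exterior.InJ R n G x →
    ∀ (S : Subset n) → CommutativeRing._≈_ R (x S) (CommutativeRing.0# R)
theorem2p16 R n G loopless simple x support x∈J =
  -- The list comes from the given derivation, and the dual functionals are built afterwards for
  -- this list.
  let D , collinear , vanish = certify-J x∈J in
  coefficients-vanish collinear x support λ S →
    vanish (dual collinear S) (dual-alternating collinear S) (dual-kills collinear S)
  where
  open Functionals R n
  open Annihilation G loopless simple
  open Independence R G loopless simple
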